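{- Let $a,b,c$ be nonzero real numbers, let $w_0,w_1$ be arbitrary real initial values, and let $\{w_n\}$ be the associated generalized bi-periodic Horadam sequence. Then for all positive integers $n$ and $m$, $$\left(\frac ba\right)^{\zeta(mn+n)}w_{n+1}w_m+\left(\frac ba\right)^{\zeta(mn+m)}c\,w_n w_{m-1}=w_1w_{m+n}+\left(\frac ba\right)^{\zeta(m+n)}c\,w_0w_{m+n-1}.$$
   Context: For nonzero real numbers $a,b,c$ and real initial values $w_0,w_1$, the generalized bi-periodic Horadam sequence $\{w_n\}$ is defined by $w_n=\chi(n)w_{n-1}+c\,w_{n-2}$ for $n\ge 2$, where $\chi(n)=a$ if $n$ is even and $\chi(n)=b$ if $n$ is odd. The parity function is $\zeta(n)=0$ if $n$ is even and $\zeta(n)=1$ if $n$ is odd. -}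

module Defs where

open import Algebra.Bundles using (CommutativeRing)
open import Data.Nat.Base as ℕ using (ℕ; suc; parity)
import Data.Nat.Properties as ℕ
open import Data.Parity.Base using (0ℙ; 1ℙ)
open import Data.Product.Base using (∃-syntax; _×_; _,_; proj₁; proj₂)
open import Data.Rational.Base as ℚ using (ℚ; 0ℚ; 1ℚ; ½)
import Data.Rational.Properties as ℚ
open import Data.Rational.Solver using (module +-*-Solver)
open import Function.Base using (_∘_)
open import Level using (0ℓ)
open import Relation.Binary.PropositionalEquality
  using (_≡_; _≢_; refl; sym; trans; cong; cong₂; subst)
open import Relation.Nullary using (yes; no; contradiction)

open +-*-Solver using (solve; _:=_; _:+_; _:*_; _:-_; :-_; con)

-- The reals are Cauchy sequences of rationals (ℝ) up to null sequences (_≃_).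

Eventually : (ℕ → Set) → Set
Eventually P = ∃[ N ] (∀ n → N ℕ.≤ n → P n)

Null : (ℕ → ℚ) → Set
Null s = ∀ ε → 0ℚ ℚ.< ε → Eventually λ n → ℚ.∣ s n ∣ ℚ.< ε

Cauchy : (ℕ → ℚ) → Set
Cauchy s = ∀ ε → 0ℚ ℚ.< ε →
  ∃[ N ] (∀ m n → N ℕ.≤ m → N ℕ.≤ n → ℚ.∣ s m ℚ.- s n ∣ ℚ.< ε)

record ℝ : Set where
  constructor mkℝ
  field
    seq    : ℕ → ℚ
    cauchy : Cauchy seq

open ℝ public

infix 4 _≃_ _#_

-- A record, so that x and y can be inferred from x ≃ y.
record _≃_ (x y : ℝ) : Set where
  constructor close
  field
    difference : Null λ n → seq x n ℚ.- seq y n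

open _≃_ public

-- Apartness, the constructive form of inequality: the distance is bounded
-- below by a positive rational.  Classically, x # y is the negation of x ≃ y.
_#_ : ℝ → ℝ → Set
x # y = ∃[ δ ] (0ℚ ℚ.< δ × Eventually λ n → δ ℚ.≤ ℚ.∣ seq x n ℚ.- seq y n ∣)

private

  both : ∀ {P Q : ℕ → Set} → Eventually P → Eventually Q →
         Eventually λ n → P n × Q n
  both (M , p) (N , q) = M ℕ.⊔ N , λ n M⊔N≤n →
    p n (ℕ.≤-trans (ℕ.m≤m⊔n M N) M⊔N≤n) , q n (ℕ.≤-trans (ℕ.m≤n⊔m M N) M⊔N≤n)

  both₂ : ∀ {P Q R : ℕ → ℕ → Set} → (∀ m n → P m n → Q m n → R m n) →
          ∃[ N ] (∀ m n → N ℕ.≤ m → N ℕ.≤ n → P m n) →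
          ∃[ N ] (∀ m n → N ℕ.≤ m → N ℕ.≤ n → Q m n) →
          ∃[ N ] (∀ m n → N ℕ.≤ m → N ℕ.≤ n → R m n)
  both₂ f (M , p) (N , q) = M ℕ.⊔ N , λ m n M⊔N≤m M⊔N≤n →
    f m n
      (p m n (ℕ.≤-trans (ℕ.m≤m⊔n M N) M⊔N≤m) (ℕ.≤-trans (ℕ.m≤m⊔n M N) M⊔N≤n))
      (q m n (ℕ.≤-trans (ℕ.m≤n⊔m M N) M⊔N≤m) (ℕ.≤-trans (ℕ.m≤n⊔m M N) M⊔N≤n))

  Eventually₂ : ∀ {P : ℕ → Set} → Eventually P →
                ∃[ N ] (∀ m n → N ℕ.≤ m → N ℕ.≤ n → P m × P n)
  Eventually₂ (N , p) = N , λ m n N≤m N≤n → p m N≤m , p n N≤n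

private abstract

  0<* : ∀ {p q} → 0ℚ ℚ.< p → 0ℚ ℚ.< q → 0ℚ ℚ.< p ℚ.* q
  0<* {p} {q} 0<p 0<q = ℚ.positive⁻¹ (p ℚ.* q)
    {{ℚ.pos*pos⇒pos p {{ℚ.positive 0<p}} q {{ℚ.positive 0<q}}}}

  0<+ : ∀ {p q} → 0ℚ ℚ.< p → 0ℚ ℚ.< q → 0ℚ ℚ.< p ℚ.+ q
  0<+ {p} {q} = ℚ.+-mono-< {0ℚ} {p} {0ℚ} {q}

  0<½* : ∀ {ε} → 0ℚ ℚ.< ε → 0ℚ ℚ.< ½ ℚ.* ε
  0<½* = 0<* (ℚ.positive⁻¹ ½)

  halves : ∀ ε → ½ ℚ.* ε ℚ.+ ½ ℚ.* ε ≡ ε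
  halves = solve 1 (λ ε → con ½ :* ε :+ con ½ :* ε := ε) refl

  ∣-∣-sym : ∀ p q → ℚ.∣ p ℚ.- q ∣ ≡ ℚ.∣ q ℚ.- p ∣
  ∣-∣-sym p q = trans
    (cong ℚ.∣_∣ (solve 2 (λ p q → p :- q := :- (q :- p)) refl p q))
    (ℚ.∣-p∣≡∣p∣ (q ℚ.- p))

  +-small : ∀ {p q ε} → ℚ.∣ p ∣ ℚ.< ½ ℚ.* ε → ℚ.∣ q ∣ ℚ.< ½ ℚ.* ε →
            ℚ.∣ p ℚ.+ q ∣ ℚ.< ε
  +-small {p} {q} {ε} ∣p∣< ∣q∣< = ℚ.≤-<-trans (ℚ.∣p+q∣≤∣p∣+∣q∣ p q)
    (subst (_ ℚ.<_) (halves ε) (ℚ.+-mono-< ∣p∣< ∣q∣<))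

  *-small : ∀ {p q B e} → 0ℚ ℚ.< B → 0ℚ ℚ.< e → ℚ.∣ p ∣ ℚ.< B → ℚ.∣ q ∣ ℚ.< e →
            ℚ.∣ p ℚ.* q ∣ ℚ.< B ℚ.* e
  *-small {p} {q} {B} {e} 0<B 0<e ∣p∣<B ∣q∣<e =
    subst (ℚ._< B ℚ.* e) (sym (ℚ.∣p*q∣≡∣p∣*∣q∣ p q))
      (ℚ.≤-<-trans
        (ℚ.*-monoʳ-≤-nonNeg ℚ.∣ q ∣ {{ℚ.∣-∣-nonNeg q}} (ℚ.<⇒≤ ∣p∣<B))
        (ℚ.*-monoʳ-<-pos B {{ℚ.positive 0<B}} ∣q∣<e))

  tolerance : ∀ {B ε} → 0ℚ ℚ.< B → 0ℚ ℚ.< ε → ∃[ e ] (0ℚ ℚ.< e × B ℚ.* e ≡ ½ ℚ.* ε)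
  tolerance {B} {ε} 0<B 0<ε =
    B⁻¹ ℚ.* (½ ℚ.* ε) ,
    0<* (ℚ.positive⁻¹ B⁻¹ {{ℚ.1/pos⇒pos B}}) (0<½* 0<ε) ,
    trans (sym (ℚ.*-assoc B B⁻¹ _))
      (trans (cong (ℚ._* (½ ℚ.* ε)) (ℚ.*-inverseʳ B)) (ℚ.*-identityˡ _))
    where
    instance
      B-pos : ℚ.Positive B
      B-pos = ℚ.positive 0<B
      B-nonZero : ℚ.NonZero B
      B-nonZero = ℚ.pos⇒nonZero B
    B⁻¹ : ℚ
    B⁻¹ = ℚ.1/ B

  product-close : ∀ {B e ε} p q p′ q′ → 0ℚ ℚ.< B → 0ℚ ℚ.< e → B ℚ.* e ≡ ½ ℚ.* ε →
                  ℚ.∣ p ∣ ℚ.< B → ℚ.∣ q′ ∣ ℚ.< B →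
                  ℚ.∣ p ℚ.- p′ ∣ ℚ.< e → ℚ.∣ q ℚ.- q′ ∣ ℚ.< e →
                  ℚ.∣ p ℚ.* q ℚ.- p′ ℚ.* q′ ∣ ℚ.< ε
  product-close {B} {e} {ε} p q p′ q′ 0<B 0<e Be≡ p<B q′<B p-p′<e q-q′<e =
    subst (λ r → ℚ.∣ r ∣ ℚ.< ε)
      (solve 4 (λ p q p′ q′ → p :* (q :- q′) :+ q′ :* (p :- p′) := p :* q :- p′ :* q′)
        refl p q p′ q′)
      (+-small
        (subst (_ ℚ.<_) Be≡ (*-small 0<B 0<e p<B q-q′<e))
        (subst (_ ℚ.<_) Be≡ (*-small 0<B 0<e q′<B p-p′<e)))

  bounded : ∀ x → ∃[ B ] (0ℚ ℚ.< B × Eventually λ n → ℚ.∣ seq x n ∣ ℚ.< B)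
  bounded x =
    1ℚ ℚ.+ ℚ.∣ seq x N ∣ ,
    ℚ.+-mono-<-≤ {0ℚ} {1ℚ} (ℚ.positive⁻¹ 1ℚ) (ℚ.0≤∣p∣ (seq x N)) ,
    N , λ n N≤n → ℚ.≤-<-trans (triangle n)
      (ℚ.+-monoˡ-< ℚ.∣ seq x N ∣ (proj₂ near n N N≤n ℕ.≤-refl))
    where
    near : ∃[ N ] (∀ m n → N ℕ.≤ m → N ℕ.≤ n → ℚ.∣ seq x m ℚ.- seq x n ∣ ℚ.< 1ℚ)
    near = cauchy x 1ℚ (ℚ.positive⁻¹ 1ℚ)
    N : ℕ
    N = proj₁ near

    triangle : ∀ n → ℚ.∣ seq x n ∣ ℚ.≤ ℚ.∣ seq x n ℚ.- seq x N ∣ ℚ.+ ℚ.∣ seq x N ∣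
    triangle n = subst (λ r → ℚ.∣ r ∣ ℚ.≤ ℚ.∣ seq x n ℚ.- seq x N ∣ ℚ.+ ℚ.∣ seq x N ∣)
      (solve 2 (λ p q → (p :- q) :+ q := p) refl (seq x n) (seq x N))
      (ℚ.∣p+q∣≤∣p∣+∣q∣ (seq x n ℚ.- seq x N) (seq x N))

  bounded₂ : ∀ x y → ∃[ B ] (0ℚ ℚ.< B ×
             Eventually λ n → ℚ.∣ seq x n ∣ ℚ.< B × ℚ.∣ seq y n ∣ ℚ.< B)
  bounded₂ x y =
    let (B , 0<B , M , x<B) = bounded x
        (C , 0<C , N , y<C) = bounded y
    in B ℚ.+ C , 0<+ {B} {C} 0<B 0<C ,
       both (M , λ n M≤n → ℚ.<-trans (x<B n M≤n) (p<p+q B 0<C))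
            (N , λ n N≤n → ℚ.<-trans (y<C n N≤n) (q<p+q C 0<B))
    where
    p<p+q : ∀ p {q} → 0ℚ ℚ.< q → p ℚ.< p ℚ.+ q
    p<p+q p {q} 0<q = subst (ℚ._< p ℚ.+ q) (ℚ.+-identityʳ p) (ℚ.+-monoʳ-< p {0ℚ} {q} 0<q)

    q<p+q : ∀ q {p} → 0ℚ ℚ.< p → q ℚ.< p ℚ.+ q
    q<p+q q {p} 0<p = subst (ℚ._< p ℚ.+ q) (ℚ.+-identityˡ q) (ℚ.+-monoˡ-< q {0ℚ} {p} 0<p)

infix  8 -_
infixl 7 _*_
infixl 6 _+_

fromℚ : ℚ → ℝ
fromℚ q = mkℝ (λ _ → q) λ ε 0<ε → 0 , λ _ _ _ _ →
  subst (λ r → ℚ.∣ r ∣ ℚ.< ε) (sym (ℚ.+-inverseʳ q)) 0<ε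

0ℝ 1ℝ : ℝ
0ℝ = fromℚ 0ℚ
1ℝ = fromℚ 1ℚ

private abstract

  +-cauchy : ∀ x y → Cauchy λ n → seq x n ℚ.+ seq y n
  +-cauchy x y ε 0<ε =
    both₂
      (λ m n p q → subst (λ r → ℚ.∣ r ∣ ℚ.< ε)
        (solve 4 (λ a b c d → (a :- b) :+ (c :- d) := (a :+ c) :- (b :+ d)) refl
          (seq x m) (seq x n) (seq y m) (seq y n))
        (+-small p q))
      (cauchy x (½ ℚ.* ε) (0<½* 0<ε)) (cauchy y (½ ℚ.* ε) (0<½* 0<ε))

  neg-cauchy : ∀ x → Cauchy λ n → ℚ.- seq x n
  neg-cauchy x ε 0<ε = let (N , p) = cauchy x ε 0<ε in
    N , λ m n N≤m N≤n → subst (λ r → ℚ.∣ r ∣ ℚ.< ε)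
      (solve 2 (λ a b → b :- a := (:- a) :- (:- b)) refl (seq x m) (seq x n))
      (p n m N≤n N≤m)

  *-cauchy : ∀ x y → Cauchy λ n → seq x n ℚ.* seq y n
  *-cauchy x y ε 0<ε =
    let (B , 0<B , bound) = bounded₂ x y
        (e , 0<e , Be≡)   = tolerance 0<B 0<ε
    in both₂ {Q = λ m n → ℚ.∣ seq x m ℚ.- seq x n ∣ ℚ.< e × ℚ.∣ seq y m ℚ.- seq y n ∣ ℚ.< e}
      (λ { m n ((xm<B , _) , (_ , yn<B)) (x-close , y-close) →
        product-close (seq x m) (seq y m) (seq x n) (seq y n)
          0<B 0<e Be≡ xm<B yn<B x-close y-close })
      (Eventually₂ bound)
      (both₂ (λ _ _ → _,_) (cauchy x e 0<e) (cauchy y e 0<e))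

_+_ : ℝ → ℝ → ℝ
x + y = mkℝ (λ n → seq x n ℚ.+ seq y n) (+-cauchy x y)

-_ : ℝ → ℝ
- x = mkℝ (λ n → ℚ.- seq x n) (neg-cauchy x)

_*_ : ℝ → ℝ → ℝ
x * y = mkℝ (λ n → seq x n ℚ.* seq y n) (*-cauchy x y)

private

  recip : ℚ → ℚ
  recip q with q ℚ.≟ 0ℚ
  ... | yes _   = 0ℚ
  ... | no  q≢0 = ℚ.1/_ q {{ℚ.≢-nonZero q≢0}}

private abstract

  far⇒≢0 : ∀ {δ q} → 0ℚ ℚ.< δ → δ ℚ.≤ ℚ.∣ q ∣ → q ≢ 0ℚ
  far⇒≢0 0<δ δ≤∣q∣ refl = ℚ.<-irrefl refl (ℚ.<-≤-trans 0<δ δ≤∣q∣)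

  recip-inverse : ∀ {δ} q → 0ℚ ℚ.< δ → δ ℚ.≤ ℚ.∣ q ∣ → q ℚ.* recip q ≡ 1ℚ
  recip-inverse q 0<δ δ≤∣q∣ with q ℚ.≟ 0ℚ
  ... | yes q≡0 = contradiction q≡0 (far⇒≢0 0<δ δ≤∣q∣)
  ... | no  q≢0 = ℚ.*-inverseʳ q {{ℚ.≢-nonZero q≢0}}

  recip-close : ∀ {δ ε} p q → 0ℚ ℚ.< δ → δ ℚ.≤ ℚ.∣ p ∣ → δ ℚ.≤ ℚ.∣ q ∣ →
                ℚ.∣ p ℚ.- q ∣ ℚ.< ε ℚ.* (δ ℚ.* δ) → ℚ.∣ recip p ℚ.- recip q ∣ ℚ.< ε
  recip-close {δ} {ε} p q 0<δ δ≤p δ≤q p-q<εδδ =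
    ℚ.*-cancelʳ-<-nonNeg (δ ℚ.* δ) {{ℚ.pos⇒nonNeg (δ ℚ.* δ) {{ℚ.positive (0<* 0<δ 0<δ)}}}}
      (ℚ.≤-<-trans lower p-q<εδδ)
    where
    p⁻¹ q⁻¹ : ℚ
    p⁻¹ = recip p
    q⁻¹ = recip q
    instance
      δ-nonNeg : ℚ.NonNegative δ
      δ-nonNeg = ℚ.nonNegative (ℚ.<⇒≤ 0<δ)
      p-nonNeg : ℚ.NonNegative ℚ.∣ p ∣
      p-nonNeg = ℚ.∣-∣-nonNeg p
      d-nonNeg : ℚ.NonNegative ℚ.∣ p⁻¹ ℚ.- q⁻¹ ∣
      d-nonNeg = ℚ.∣-∣-nonNeg (p⁻¹ ℚ.- q⁻¹)

    δδ≤ : δ ℚ.* δ ℚ.≤ ℚ.∣ p ∣ ℚ.* ℚ.∣ q ∣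
    δδ≤ = ℚ.≤-trans (ℚ.*-monoʳ-≤-nonNeg δ δ≤p) (ℚ.*-monoˡ-≤-nonNeg ℚ.∣ p ∣ δ≤q)

    difference-* : (p⁻¹ ℚ.- q⁻¹) ℚ.* (p ℚ.* q) ≡ q ℚ.- p
    difference-* = trans
      (solve 4 (λ p q r s → (r :- s) :* (p :* q) := (p :* r) :* q :- (q :* s) :* p)
        refl p q p⁻¹ q⁻¹)
      (cong₂ ℚ._-_
        (trans (cong (ℚ._* q) (recip-inverse p 0<δ δ≤p)) (ℚ.*-identityˡ q))
        (trans (cong (ℚ._* p) (recip-inverse q 0<δ δ≤q)) (ℚ.*-identityˡ p)))

    lower : ℚ.∣ p⁻¹ ℚ.- q⁻¹ ∣ ℚ.* (δ ℚ.* δ) ℚ.≤ ℚ.∣ p ℚ.- q ∣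
    lower = subst (ℚ.∣ p⁻¹ ℚ.- q⁻¹ ∣ ℚ.* (δ ℚ.* δ) ℚ.≤_)
      (trans (cong (ℚ.∣ p⁻¹ ℚ.- q⁻¹ ∣ ℚ.*_) (sym (ℚ.∣p*q∣≡∣p∣*∣q∣ p q)))
        (trans (sym (ℚ.∣p*q∣≡∣p∣*∣q∣ (p⁻¹ ℚ.- q⁻¹) (p ℚ.* q)))
          (trans (cong ℚ.∣_∣ difference-*) (∣-∣-sym q p))))
      (ℚ.*-monoˡ-≤-nonNeg ℚ.∣ p⁻¹ ℚ.- q⁻¹ ∣ δδ≤)

  #0⇒far : ∀ x ((δ , _) : x # 0ℝ) → Eventually λ n → δ ℚ.≤ ℚ.∣ seq x n ∣
  #0⇒far x (δ , _ , N , far) = N , λ n N≤n →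
    subst (λ r → δ ℚ.≤ ℚ.∣ r ∣) (ℚ.+-identityʳ (seq x n)) (far n N≤n)

  recip-cauchy : ∀ x → x # 0ℝ → Cauchy (recip ∘ seq x)
  recip-cauchy x x#0@(δ , 0<δ , _) ε 0<ε =
    both₂
      (λ { m n (δ≤xm , δ≤xn) → recip-close (seq x m) (seq x n) 0<δ δ≤xm δ≤xn })
      (Eventually₂ (#0⇒far x x#0))
      (cauchy x (ε ℚ.* (δ ℚ.* δ)) (0<* 0<ε (0<* 0<δ 0<δ)))

-- The finitely many zero terms that x # 0ℝ allows are sent to 0.
inverse : (x : ℝ) → x # 0ℝ → ℝ
inverse x x#0 = mkℝ (recip ∘ seq x) (recip-cauchy x x#0)

infixl 7 _/_[_]

_/_[_] : (x y : ℝ) → y # 0ℝ → ℝ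
x / y [ y#0 ] = x * inverse y y#0

private abstract

  eventually-≡⇒≃ : ∀ {x y} → Eventually (λ n → seq x n ≡ seq y n) → x ≃ y
  eventually-≡⇒≃ {y = y} (N , eq) = close λ ε 0<ε → N , λ n N≤n →
    subst (λ r → ℚ.∣ r ∣ ℚ.< ε)
      (sym (trans (cong (ℚ._- seq y n) (eq n N≤n)) (ℚ.+-inverseʳ (seq y n)))) 0<ε

  ≡⇒≃ : ∀ {x y} → (∀ n → seq x n ≡ seq y n) → x ≃ y
  ≡⇒≃ eq = eventually-≡⇒≃ (0 , λ n _ → eq n)

abstract

  ≃-refl : ∀ {x} → x ≃ x
  ≃-refl = ≡⇒≃ λ _ → refl

  ≃-sym : ∀ {x y} → x ≃ y → y ≃ x
  ≃-sym {x} {y} x≃y = close λ ε 0<ε → let (N , p) = difference x≃y ε 0<ε in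
    N , λ n N≤n → subst (ℚ._< ε) (∣-∣-sym (seq x n) (seq y n)) (p n N≤n)

  ≃-trans : ∀ {x y z} → x ≃ y → y ≃ z → x ≃ z
  ≃-trans {x} {y} {z} x≃y y≃z = close λ ε 0<ε →
    let (N , p) = both (difference x≃y (½ ℚ.* ε) (0<½* 0<ε))
                       (difference y≃z (½ ℚ.* ε) (0<½* 0<ε))
    in N , λ n N≤n → let (x-y , y-z) = p n N≤n in
    subst (λ r → ℚ.∣ r ∣ ℚ.< ε)
      (solve 3 (λ a b c → (a :- b) :+ (b :- c) := a :- c) refl
        (seq x n) (seq y n) (seq z n))
      (+-small x-y y-z)

  +-cong : ∀ {x y u v} → x ≃ y → u ≃ v → x + u ≃ y + v
  +-cong {x} {y} {u} {v} x≃y u≃v = close λ ε 0<ε →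
    let (N , p) = both (difference x≃y (½ ℚ.* ε) (0<½* 0<ε))
                       (difference u≃v (½ ℚ.* ε) (0<½* 0<ε))
    in N , λ n N≤n → let (x-y , u-v) = p n N≤n in
    subst (λ r → ℚ.∣ r ∣ ℚ.< ε)
      (solve 4 (λ a b c d → (a :- b) :+ (c :- d) := (a :+ c) :- (b :+ d)) refl
        (seq x n) (seq y n) (seq u n) (seq v n))
      (+-small x-y u-v)

  -‿cong : ∀ {x y} → x ≃ y → - x ≃ - y
  -‿cong {x} {y} x≃y = close λ ε 0<ε → let (N , p) = difference (≃-sym x≃y) ε 0<ε in
    N , λ n N≤n → subst (λ r → ℚ.∣ r ∣ ℚ.< ε)
      (solve 2 (λ a b → b :- a := (:- a) :- (:- b)) refl (seq x n) (seq y n)) (p n N≤n)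

  *-cong : ∀ {x y u v} → x ≃ y → u ≃ v → x * u ≃ y * v
  *-cong {x} {y} {u} {v} x≃y u≃v = close λ ε 0<ε →
    let (B , 0<B , bound) = bounded₂ x v
        (e , 0<e , Be≡)   = tolerance 0<B 0<ε
        (N , p)           = both bound (both (difference x≃y e 0<e) (difference u≃v e 0<e))
    in N , λ n N≤n → let ((x<B , v<B) , (x-y , u-v)) = p n N≤n in
    product-close (seq x n) (seq u n) (seq y n) (seq v n) 0<B 0<e Be≡ x<B v<B x-y u-v

ℝ-commutativeRing : CommutativeRing 0ℓ 0ℓ
ℝ-commutativeRing = record
  { Carrier = ℝ ; _≈_ = _≃_ ; _+_ = _+_ ; _*_ = _*_ ; -_ = -_ ; 0# = 0ℝ ; 1# = 1ℝ
  ; isCommutativeRing = record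
    { isRing = record
      { +-isAbelianGroup = record
        { isGroup = record
          { isMonoid = record
            { isSemigroup = record
              { isMagma = record
                { isEquivalence = record
                  { refl = ≃-refl ; sym = ≃-sym ; trans = ≃-trans }
                ; ∙-cong = +-cong
                }
              ; assoc = λ x y z → ≡⇒≃ λ n →
                  ℚ.+-assoc (seq x n) (seq y n) (seq z n)
              }
            ; identity = (λ x → ≡⇒≃ λ n → ℚ.+-identityˡ (seq x n))
                       , (λ x → ≡⇒≃ λ n → ℚ.+-identityʳ (seq x n))
            }
          ; inverse = (λ x → ≡⇒≃ λ n → ℚ.+-inverseˡ (seq x n))
                    , (λ x → ≡⇒≃ λ n → ℚ.+-inverseʳ (seq x n))
          ; ⁻¹-cong = -‿cong
          }
        ; comm = λ x y → ≡⇒≃ λ n → ℚ.+-comm (seq x n) (seq y n)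
        }
      ; *-cong = *-cong
      ; *-assoc = λ x y z → ≡⇒≃ λ n →
          ℚ.*-assoc (seq x n) (seq y n) (seq z n)
      ; *-identity = (λ x → ≡⇒≃ λ n → ℚ.*-identityˡ (seq x n))
                   , (λ x → ≡⇒≃ λ n → ℚ.*-identityʳ (seq x n))
      ; distrib = (λ x y z → ≡⇒≃ λ n →
                    ℚ.*-distribˡ-+ (seq x n) (seq y n) (seq z n))
                , (λ x y z → ≡⇒≃ λ n →
                    ℚ.*-distribʳ-+ (seq x n) (seq y n) (seq z n))
      }
    ; *-comm = λ x y → ≡⇒≃ λ n → ℚ.*-comm (seq x n) (seq y n)
    }
  }

abstract

  *-inverseʳ : ∀ x (x#0 : x # 0ℝ) → x * inverse x x#0 ≃ 1ℝ
  *-inverseʳ x x#0@(δ , 0<δ , _) = let (N , far) = #0⇒far x x#0 in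
    eventually-≡⇒≃ (N , λ n N≤n → recip-inverse (seq x n) 0<δ (far n N≤n))

open import Algebra.Properties.Semiring.Exp
  (CommutativeRing.semiring ℝ-commutativeRing) public using (_^_)

ζ : ℕ → ℕ
ζ n with parity n
... | 0ℙ = 0
... | 1ℙ = 1

χ : (a b : ℝ) → ℕ → ℝ
χ a b n with parity n
... | 0ℙ = a
... | 1ℙ = b

horadam : (a b c w₀ w₁ : ℝ) → ℕ → ℝ
horadam a b c w₀ w₁ 0 = w₀
horadam a b c w₀ w₁ 1 = w₁
horadam a b c w₀ w₁ n@(suc (suc k)) =
  χ a b n * horadam a b c w₀ w₁ (suc k) + c * horadam a b c w₀ w₁ k

{-# OPTIONS --safe #-}

-- The left-hand side depends only on m + n, and at m = 1 it is the right-hand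
-- side.  Trading one unit of m for one of n amounts, after expanding the
-- recurrence once on each side, to the identity
--   r ^ ζ(mn) χ(m + 1) = r ^ ζ((m + 1)(n + 1)) χ(n),
-- which depends only on the parities of m and n and follows from r a = b.

module Submission where

open import Defs
open import Algebra.Bundles using (CommutativeRing)
import Algebra.Solver.Ring.NaturalCoefficients.Default as RingSolver
open import Data.Nat.Base as ℕ using (ℕ; zero; suc; parity; _<_; _∸_)
import Data.Nat.Properties as ℕ
open import Data.Nat.Solver using (module +-*-Solver)
open import Data.Parity.Base using (0ℙ; 1ℙ)
import Data.Parity.Properties as ℙ
open import Relation.Binary.PropositionalEquality
  using (_≡_; refl; sym; trans; cong; cong₂)
import Relation.Binary.Reasoning.Setoid as SetoidReasoning

open CommutativeRing ℝ-commutativeRing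
  using (setoid; commutativeSemiring; *-assoc; *-comm; *-identityˡ; *-identityʳ)
open SetoidReasoning setoid
open RingSolver commutativeSemiring using (solve; _:=_; _:+_; _:*_)

private module ℕS = +-*-Solver

-- Every parity is its own negative, so a doubled summand vanishes. This is how exponents such as
-- `suc m * n + n` are brought back to `m * n`.
ζ-n+n+m : ∀ n m → ζ (n ℕ.+ n ℕ.+ m) ≡ ζ m
ζ-n+n+m n m
  rewrite ℙ.+-homo-+ (n ℕ.+ n) m | ℙ.+-homo-+ n n | ℙ.p+p≡0ℙ (parity n) = refl

/-cancel : ∀ a b (a#0 : a # 0ℝ) → b / a [ a#0 ] * a ≃ b
/-cancel a b a#0 = begin
  b * inverse a a#0 * a    ≈⟨ *-assoc b (inverse a a#0) a ⟩
  b * (inverse a a#0 * a)  ≈⟨ *-cong ≃-refl (*-comm (inverse a a#0) a) ⟩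
  b * (a * inverse a a#0)  ≈⟨ *-cong ≃-refl (*-inverseʳ a a#0) ⟩
  b * 1ℝ                   ≈⟨ *-identityʳ b ⟩
  b                        ∎

-- `r` stands for the quotient b/a, which enters the argument only through the equation `r * a ≃ b`.
module _ (a b r : ℝ) (ra≃b : r * a ≃ b) where

  private
    r¹a≃r⁰b : r ^ 1 * a ≃ r ^ 0 * b
    r¹a≃r⁰b = begin
      r ^ 1 * a  ≈⟨ *-cong (*-identityʳ r) ≃-refl ⟩
      r * a      ≈⟨ ra≃b ⟩
      b          ≈⟨ *-identityˡ b ⟨
      r ^ 0 * b  ∎

  ^ζ-χ-exchange : ∀ m n →
    r ^ ζ (m ℕ.* n) * χ a b (suc m) ≃ r ^ ζ (suc m ℕ.* suc n) * χ a b n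
  ^ζ-χ-exchange m n
    -- All occurring parities are expressed through those of `suc m` and `suc n`, so that one split
    -- on these two decides every `ζ` and `χ`.
    rewrite ℙ.*-homo-* m n | ℙ.*-homo-* (suc m) (suc n)
          | sym (ℙ.suc-homo-⁻¹ m) | sym (ℙ.suc-homo-⁻¹ n)
    with parity (suc m) | parity (suc n)
  -- Here `m` and `n` are both odd: `m * n` is odd and `suc m * suc n` even. When both are even the
  -- roles swap; with mixed parities both products are even and `χ` agrees.
  ... | 0ℙ | 0ℙ = r¹a≃r⁰b
  ... | 0ℙ | 1ℙ = ≃-refl
  ... | 1ℙ | 0ℙ = ≃-refl
  ... | 1ℙ | 1ℙ = ≃-sym r¹a≃r⁰b

  module _ (c w₀ w₁ : ℝ) where

    private
      w : ℕ → ℝ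
      w = horadam a b c w₀ w₁

    convolution : ℕ → ℕ → ℝ
    convolution m n =
      r ^ ζ (m ℕ.* n ℕ.+ n) * w (suc n) * w m + r ^ ζ (m ℕ.* n ℕ.+ m) * c * w n * w (m ∸ 1)

    convolution-shift : ∀ k n → convolution (2 ℕ.+ k) n ≃ convolution (1 ℕ.+ k) (suc n)
    convolution-shift k n = begin
      r ^ ζ (suc m ℕ.* n ℕ.+ n) * w (suc n) * w (suc m)
        + r ^ ζ (suc m ℕ.* n ℕ.+ suc m) * c * w n * w m
        ≡⟨ cong₂ (λ i j → r ^ i * w (suc n) * w (suc m) + r ^ j * c * w n * w m)
             (trans
               (cong ζ (ℕS.solve 2 (λ m n →
                 (ℕS.con 1 ℕS.:+ m) ℕS.:* n ℕS.:+ n ℕS.:= n ℕS.:+ n ℕS.:+ m ℕS.:* n) refl m n))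
               (ζ-n+n+m n (m ℕ.* n)))
             (cong ζ (trans (ℕ.+-comm (suc m ℕ.* n) (suc m)) (sym (ℕ.*-suc (suc m) n)))) ⟩
      x * w (suc n) * (χ a b (suc m) * w m + c * w k) + y * c * w n * w m
        -- With `w (suc m)` expanded, the two terms carrying `c` are already those of the target;
        -- only the `χ` term has to change.
        ≈⟨ solve 8 (λ x y c h u v w z →
             x :* u :* (h :* v :+ c :* w) :+ y :* c :* z :* v
             := (x :* h) :* (u :* v) :+ (x :* c :* u :* w :+ y :* c :* z :* v))
             ≃-refl x y c (χ a b (suc m)) (w (suc n)) (w m) (w k) (w n) ⟩
      (x * χ a b (suc m)) * (w (suc n) * w m) + (x * c * w (suc n) * w k + y * c * w n * w m)
        ≈⟨ +-cong (*-cong (^ζ-χ-exchange m n) ≃-refl) ≃-refl ⟩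
      (y * χ a b n) * (w (suc n) * w m) + (x * c * w (suc n) * w k + y * c * w n * w m)
        ≈⟨ solve 8 (λ x y c h u v w z →
             (y :* h) :* (u :* v) :+ (x :* c :* u :* w :+ y :* c :* z :* v)
             := y :* (h :* u :+ c :* z) :* v :+ x :* c :* u :* w)
             ≃-refl x y c (χ a b n) (w (suc n)) (w m) (w k) (w n) ⟩
      y * (χ a b n * w (suc n) + c * w n) * w m + x * c * w (suc n) * w k
        -- The bracket is `w (2 + n)` by computation, since `χ a b (2 + n)` reduces to `χ a b n`.
        ≡⟨ cong₂ (λ i j → r ^ i * w (2 ℕ.+ n) * w m + r ^ j * c * w (suc n) * w k)
             (cong ζ (ℕ.+-comm (suc n) (m ℕ.* suc n)))
             (trans
               (sym (ζ-n+n+m m (m ℕ.* n)))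
               (cong ζ (ℕS.solve 2 (λ m n →
                 m ℕS.:+ m ℕS.:+ m ℕS.:* n ℕS.:= m ℕS.:* (ℕS.con 1 ℕS.:+ n) ℕS.:+ m) refl m n))) ⟩
      r ^ ζ (m ℕ.* suc n ℕ.+ suc n) * w (2 ℕ.+ n) * w m
        + r ^ ζ (m ℕ.* suc n ℕ.+ m) * c * w (suc n) * w k
        ∎
      where
      m = suc k
      x = r ^ ζ (m ℕ.* n)
      y = r ^ ζ (suc m ℕ.* suc n)

    total : ℕ → ℝ
    total s = w₁ * w s + r ^ ζ s * c * w₀ * w (s ∸ 1)

    -- Induction on `k` with `n` left free: each shift lowers the first index and raises the second,
    -- keeping their sum, until the first index is 1.
    convolution≃total : ∀ k n → convolution (suc k) n ≃ total (suc k ℕ.+ n)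
    convolution≃total zero n = begin
      r ^ ζ (1 ℕ.* n ℕ.+ n) * w (suc n) * w₁ + r ^ ζ (1 ℕ.* n ℕ.+ 1) * c * w n * w₀
        -- The first exponent is the parity of `n + n`, hence 0, and the power becomes `1ℝ`.
        ≡⟨ cong₂ (λ i j → r ^ i * w (suc n) * w₁ + r ^ j * c * w n * w₀)
             (trans
               (cong ζ (ℕS.solve 1 (λ n →
                 ℕS.con 1 ℕS.:* n ℕS.:+ n ℕS.:= n ℕS.:+ n ℕS.:+ ℕS.con 0) refl n))
               (ζ-n+n+m n 0))
             (cong ζ (trans (ℕ.+-comm (1 ℕ.* n) 1) (cong suc (ℕ.*-identityˡ n)))) ⟩
      1ℝ * w (suc n) * w₁ + z * c * w n * w₀
        ≈⟨ +-cong (*-cong (*-identityˡ (w (suc n))) ≃-refl) ≃-refl ⟩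
      w (suc n) * w₁ + z * c * w n * w₀
        ≈⟨ solve 6 (λ z c u v p q → u :* q :+ z :* c :* v :* p := q :* u :+ z :* c :* p :* v)
             ≃-refl z c (w (suc n)) (w n) w₀ w₁ ⟩
      total (suc n)
        ∎
      where
      z = r ^ ζ (suc n)
    convolution≃total (suc k) n = begin
      convolution (2 ℕ.+ k) n      ≈⟨ convolution-shift k n ⟩
      convolution (suc k) (suc n)  ≈⟨ convolution≃total k (suc n) ⟩
      total (suc k ℕ.+ suc n)      ≡⟨ cong total (ℕ.+-suc (suc k) n) ⟩
      total (2 ℕ.+ k ℕ.+ n)        ∎

theorem5 : (a b c w₀ w₁ : ℝ) (a#0 : a # 0ℝ) → b # 0ℝ → c # 0ℝ →
    (n m : ℕ) → 0 < n → 0 < m →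
    let w = horadam a b c w₀ w₁
        r = b / a [ a#0 ]
    in r ^ ζ (m ℕ.* n ℕ.+ n) * w (n ℕ.+ 1) * w m
         + r ^ ζ (m ℕ.* n ℕ.+ m) * c * w n * w (m ∸ 1)
       ≃ w₁ * w (m ℕ.+ n)
         + r ^ ζ (m ℕ.+ n) * c * w₀ * w (m ℕ.+ n ∸ 1)
-- Positivity of `m` leaves only `m = suc k`, so `m ∸ 1` is `k`; the rewrite turns `n + 1` into
-- `suc n`.
theorem5 a b c w₀ w₁ a#0 _ _ n (suc k) _ _ rewrite ℕ.+-comm n 1 =
  convolution≃total a b (b / a [ a#0 ]) (/-cancel a b a#0) c w₀ w₁ k n
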